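{- Let $F$ be a saturated minimally unsatisfiable clause-set. Then singular DP-reduction is confluent on $F$, i.e., $|\mathrm{sDP}(F)| = 1$. In other words, the class of saturated minimally unsatisfiable clause-sets is contained in the class of $F \in \mathrm{MU}$ with $|\mathrm{sDP}(F)|=1$.
   Context: Literals are variables $v$ and their complements $\overline{v}$. A clause is a finite set of literals containing no complementary pair; a clause-set is a finite set of clauses. $\mathrm{var}(F)$ is the set of variables occurring in $F$. For a literal $x$, $\mathrm{ldeg}_F(x)$ is the number of clauses of $F$ containing $x$. For a variable $v$, the DP-reduction is $\mathrm{DP}_v(F) := \{C \in F : v \notin \mathrm{var}(C)\} \cup \{(C \cup D)\setminus\{v,\overline{v}\} : C, D \in F,\ C \cap \overline{D} = \{v\}\}$ (where $\overline{D}=\{\overline{y}: y\in D\}$). $\mathrm{MU}$ is the set of minimally unsatisfiable clause-sets (unsatisfiable, but every proper subset is satisfiable). $F \in \mathrm{MU}$ is saturated if for every $C \in F$ and every literal $x$ with $\mathrm{var}(x) \in \mathrm{var}(F)\setminus \mathrm{var}(C)$, the clause-set $(F\setminus\{C\})\cup\{C\cup\{x\}\}$ is satisfiable. A variable $v$ is singular for $F$ if $\min(\mathrm{ldeg}_F(v),\mathrm{ldeg}_F(\overline{v}))=1$; $F$ is nonsingular if it has no singular variable. A singular DP-reduction step is $F \leadsto \mathrm{DP}_v(F)$ for $F\in \mathrm{MU}$ and $v$ singular for $F$ (the result is again in $\mathrm{MU}$). $\mathrm{sDP}(F)$ is the set of nonsingular $F' \in \mathrm{MU}$ obtainable from $F$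 by zero or more singular DP-reduction steps. -}

module Defs where

open import Data.Bool using (Bool; true; false; not)
import Data.Bool.Properties as Bool
open import Data.List using (List; []; _∷_; [_]; _++_; map; concatMap; mapMaybe; filter;
  deduplicate; length; cartesianProduct)
open import Data.List.Membership.Propositional.Properties using (∈-++⁻; ∈-filter⁺; ∈-filter⁻; ∈-map⁺)
import Data.List.Membership.DecPropositional as DecMembership
import Data.List.Membership.DecSetoid as DecSetoidMembership
import Data.List.Relation.Binary.Subset.DecPropositional as DecSubset
import Data.List.Relation.Binary.Subset.Setoid as SetoidSubset
open import Data.List.Relation.Unary.All using (All)
open import Data.List.Relation.Unary.Any using (Any; here; there)
import Data.Maybe as Maybe
open import Data.Nat using (ℕ; _⊓_)
open import Data.Product using (_×_; _,_; ∃-syntax; proj₁)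
open import Data.Product.Properties using (≡-dec)
open import Data.Sum using (inj₁; inj₂)
open import Relation.Binary using (DecidableEquality; Decidable; DecSetoid)
open import Relation.Binary.Construct.Closure.ReflexiveTransitive using (Star)
open import Relation.Binary.PropositionalEquality using (_≡_; refl; sym; cong; subst)
open import Relation.Nullary using (¬_; Dec)
open import Relation.Nullary.Decidable using (¬?; _×-dec_; dec⇒maybe)

module ClauseSets (V : Set) (_≟ⱽ_ : DecidableEquality V) where

  -- (v , true) is the variable v, (v , false) its complement.

  Literal : Set
  Literal = V × Bool

  _≟ᴸ_ : DecidableEquality Literal
  _≟ᴸ_ = ≡-dec _≟ⱽ_ Bool._≟_

  pos neg : V → Literal
  pos v = v , true
  neg v = v , false

  var : Literal → V
  var = proj₁

  comp : Literal → Literal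
  comp (v , b) = v , not b

  comp-involutive : ∀ x → comp (comp x) ≡ x
  comp-involutive (v , b) = cong (v ,_) (Bool.not-involutive b)

  comp≢ : ∀ x → ¬ (comp x ≡ x)
  comp≢ (v , true)  ()
  comp≢ (v , false) ()

  -- A list of literals stands for the set of its elements.

  open DecMembership _≟ᴸ_ public using (_∈_; _∉_; _∈?_)
  open DecSubset _≟ᴸ_ public using (_⊆_; _⊆?_)

  infix 4 _≈ᴸ_ _≈ᴸ?_

  _≈ᴸ_ : List Literal → List Literal → Set
  xs ≈ᴸ ys = xs ⊆ ys × ys ⊆ xs

  _≈ᴸ?_ : Decidable _≈ᴸ_
  xs ≈ᴸ? ys = (xs ⊆? ys) ×-dec (ys ⊆? xs)

  infixr 7 _∩_
  infixr 6 _∪_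
  infixl 5 _∖_

  _∩_ _∪_ _∖_ : List Literal → List Literal → List Literal
  xs ∩ ys = filter (_∈? ys) xs
  xs ∪ ys = xs ++ ys
  xs ∖ ys = filter (λ x → ¬? (x ∈? ys)) xs

  record Clause : Set where
    constructor mkClause
    field
      literals   : List Literal
      consistent : ∀ {x} → x ∈ literals → comp x ∉ literals

  open Clause public

  infix 4 _≈_

  _≈_ : Clause → Clause → Set
  C ≈ D = literals C ≈ᴸ literals D

  clauseDecSetoid : DecSetoid _ _
  clauseDecSetoid = record
    { Carrier = Clause
    ; _≈_     = _≈_
    ; isDecEquivalence = record
      { isEquivalence = record
        { refl  = (λ p → p) , (λ p → p)
        ; sym   = λ (p , q) → q , p
        ; trans = λ (p , q) (p′ , q′) → (λ z → p′ (p z)) , (λ z → q (q′ z))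
        }
      ; _≟_ = λ C D → literals C ≈ᴸ? literals D
      }
    }

  open DecSetoid clauseDecSetoid public using () renaming (_≟_ to _≈?_)

  open DecMembership _≟ⱽ_ public using ()
    renaming (_∈_ to _∈ⱽ_; _∉_ to _∉ⱽ_; _∈?_ to _∈ⱽ?_; _∉?_ to _∉ⱽ?_)

  vars : Clause → List V
  vars C = map var (literals C)

  adjoin : (C : Clause) (x : Literal) → var x ∉ⱽ vars C → Clause
  adjoin C x x∉ = mkClause (x ∷ literals C) λ where
    (here refl) (here eq)  → comp≢ x eq
    (here refl) (there q)  → x∉ (∈-map⁺ var q)
    (there p)   (here refl) → x∉ (∈-map⁺ var p)
    (there p)   (there q)  → consistent C p q

  -- A list of clauses stands for the set of its elements, where clauses are
  -- identified when they are equal as sets of literals.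

  ClauseSet : Set
  ClauseSet = List Clause

  open DecSetoidMembership clauseDecSetoid public using ()
    renaming (_∈_ to _∈ᶜ_; _∉_ to _∉ᶜ_; _∈?_ to _∈ᶜ?_)
  open SetoidSubset (DecSetoid.setoid clauseDecSetoid) public using ()
    renaming (_⊆_ to _⊆ᶜ_)

  infix 4 _≋_

  _≋_ : ClauseSet → ClauseSet → Set
  F ≋ G = F ⊆ᶜ G × G ⊆ᶜ F

  Vars : ClauseSet → List V
  Vars = concatMap vars

  remove : Clause → ClauseSet → ClauseSet
  remove C = filter (λ D → ¬? (C ≈? D))

  -- The list may repeat a clause, so duplicates are discarded before counting.
  ldeg : ClauseSet → Literal → ℕ
  ldeg F x = length (filter (λ C → x ∈? literals C) (deduplicate _≈?_ F))

  Assignment : Set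
  Assignment = V → Bool

  _⊨_ : Assignment → Clause → Set
  φ ⊨ C = Any (λ (v , b) → φ v ≡ b) (literals C)

  Satisfiable Unsatisfiable : ClauseSet → Set
  Satisfiable F   = ∃[ φ ] All (φ ⊨_) F
  Unsatisfiable F = ¬ Satisfiable F

  MU : ClauseSet → Set
  MU F = Unsatisfiable F × (∀ {G} → G ⊆ᶜ F → ¬ (F ⊆ᶜ G) → Satisfiable G)

  SaturatedMU : ClauseSet → Set
  SaturatedMU F = MU F ×
    (∀ {C x} → C ∈ᶜ F → var x ∈ⱽ Vars F → (x∉ : var x ∉ⱽ vars C) →
      Satisfiable (adjoin C x x∉ ∷ remove C F))

  -- C ∩ D̄ = {v}
  Resolvable : V → Clause → Clause → Set
  Resolvable v C D = literals C ∩ map comp (literals D) ≈ᴸ [ pos v ]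

  resolvable? : ∀ v C D → Dec (Resolvable v C D)
  resolvable? v C D = literals C ∩ map comp (literals D) ≈ᴸ? [ pos v ]

  resolvent : ∀ v (C D : Clause) → Resolvable v C D → Clause
  resolvent v C D (C∩D̄⊆v , _) = mkClause (CD ∖ v±) cons
    where
    CD v± : List Literal
    CD = literals C ∪ literals D
    v± = pos v ∷ neg v ∷ []

    only-v : ∀ {x} → x ∈ literals C → comp x ∈ literals D → x ∈ v±
    only-v {x} p q with C∩D̄⊆v (∈-filter⁺ (_∈? map comp (literals D)) p
                      (subst (_∈ map comp (literals D)) (comp-involutive x) (∈-map⁺ comp q)))
    ... | here eq = here eq

    cons : ∀ {x} → x ∈ (CD ∖ v±) → comp x ∉ (CD ∖ v±)
    cons {x} p q with ∈-filter⁻ (λ y → ¬? (y ∈? v±)) {xs = CD} p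
                    | ∈-filter⁻ (λ y → ¬? (y ∈? v±)) {xs = CD} q
    ... | p′ , x∉v± | q′ , x̄∉v± with ∈-++⁻ (literals C) p′ | ∈-++⁻ (literals C) q′
    ... | inj₁ a | inj₁ b = consistent C a b
    ... | inj₂ a | inj₂ b = consistent D a b
    ... | inj₁ a | inj₂ b = x∉v± (only-v a b)
    ... | inj₂ a | inj₁ b = x̄∉v± (only-v b (subst (_∈ literals D) (sym (comp-involutive x)) a))

  DP : V → ClauseSet → ClauseSet
  DP v F = filter (λ C → v ∉ⱽ? vars C) F
        ++ mapMaybe (λ (C , D) → Maybe.map (resolvent v C D) (dec⇒maybe (resolvable? v C D)))
                    (cartesianProduct F F)

  Singular : ClauseSet → V → Set
  Singular F v = ldeg F (pos v) ⊓ ldeg F (neg v) ≡ 1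

  Nonsingular : ClauseSet → Set
  Nonsingular F = ∀ v → ¬ Singular F v

  infix 4 _⇝_ _⇝*_

  data _⇝_ (F : ClauseSet) : ClauseSet → Set where
    sDP-step : ∀ {v} → MU F → Singular F v → F ⇝ DP v F

  _⇝*_ : ClauseSet → ClauseSet → Set
  _⇝*_ = Star _⇝_

  -- G ∈ sDP(F); reduction produces a particular list, which is compared with G as a set.
  sDP : ClauseSet → ClauseSet → Set
  sDP F G = MU G × Nonsingular G × ∃[ H ] (F ⇝* H × H ≋ G)

{-# OPTIONS --safe #-}
module Submission where

-- Let F be saturated and let the literal x occur in exactly one clause C of F. Saturation
-- forces every literal of C other than x into each clause containing x̄, so the resolvent of C
-- with such a clause D is just D without x̄: the DP-reduction of F at var x is F under the
-- partial assignment x ↦ true. Every assignment satisfying C can be changed to make x true at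
-- no cost to the other clauses, whence the reduct is again saturated and minimally unsatisfiable.
-- Moreover, other singular variables remain singular, and partial assignments to distinct variables
-- commute. So any singular step can be moved to the front of a reduction, which gives confluence.

open import Defs
open import Data.Bool using (true; false)
import Data.Bool.Properties as Bool
open import Data.Empty using (⊥-elim)
open import Data.List using (List; []; _∷_; map; mapMaybe; filter; deduplicate;
  length; cartesianProduct)
open import Data.List.Properties using (filter-notAll)
import Data.List.Membership.Propositional as ≡Membership
open import Data.List.Membership.Propositional.Properties
  using (∈-++⁺ˡ; ∈-++⁺ʳ; ∈-++⁻; ∈-filter⁺; ∈-filter⁻; ∈-map⁺; ∈-map⁻;
  ∈-concatMap⁺; ∈-concatMap⁻; ∈-cartesianProduct⁺; ∈-cartesianProduct⁻)
import Data.List.Membership.Setoid.Properties as SetoidMembership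
open import Data.List.Relation.Unary.All as All using (All; []; _∷_)
open import Data.List.Relation.Unary.All.Properties using (¬All⇒Any¬)
open import Data.List.Relation.Unary.AllPairs using ([]; _∷_)
open import Data.List.Relation.Unary.Any as Any using (Any; here; there; any?)
import Data.List.Relation.Unary.Any.Properties as Any
import Data.List.Relation.Unary.Unique.Setoid.Properties as UniqueSetoid
open import Data.List.Relation.Unary.Unique.DecSetoid.Properties using (deduplicate-!)
import Data.Maybe as Maybe
open import Data.Maybe using (Maybe; just; nothing)
import Data.Maybe.Relation.Unary.Any as MAny
open import Data.Nat using (zero; suc; _⊓_; _≤_; z≤n; s≤s)
import Data.Nat.Properties as ℕ
open import Data.Product using (∃!; _×_; _,_; ∃-syntax; proj₁; proj₂)
open import Data.Sum as Sum using (_⊎_; inj₁; inj₂; swap)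
open import Function using (_∘_; id)
open import Relation.Binary using (DecidableEquality; DecSetoid)
open import Relation.Binary.Construct.Closure.ReflexiveTransitive using (ε; _◅_)
open import Relation.Binary.PropositionalEquality using (_≡_; _≢_; refl; sym; trans; cong; subst)
open import Relation.Nullary using (¬_; Dec; yes; no)
open import Relation.Nullary.Decidable using (¬?; dec⇒maybe)

-- Preliminaries on lists and minima.

mapMaybe⁻ : ∀ {A B : Set} {P : B → Set} (f : A → Maybe B) xs →
  Any P (mapMaybe f xs) → Any (MAny.Any P ∘ f) xs
mapMaybe⁻ f (x ∷ xs) p with f x in eq
... | nothing = there (mapMaybe⁻ f xs p)
mapMaybe⁻ {P = P} f (x ∷ xs) (here q)  | just y = here (subst (MAny.Any P) (sym eq) (MAny.just q))
mapMaybe⁻ f (x ∷ xs) (there p) | just y = there (mapMaybe⁻ f xs p)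

⊓≡1 : ∀ {m n} → m ⊓ n ≡ 1 → (m ≡ 1 × 1 ≤ n) ⊎ (n ≡ 1 × 1 ≤ m)
⊓≡1 {suc zero}    {suc n}       _ = inj₁ (refl , s≤s z≤n)
⊓≡1 {suc (suc m)} {suc zero}    _ = inj₂ (refl , s≤s z≤n)

module Confluence (V : Set) (_≟ⱽ_ : DecidableEquality V) where

  open ClauseSets V _≟ⱽ_
  open DecSetoid clauseDecSetoid using ()
    renaming (setoid to clauseSetoid)

  private variable
    D      : Clause
    F G H  : ClauseSet
    K L    : List Literal
    u x y  : Literal
    v      : V
    φ      : Assignment

  -- Literals, clauses and clause-sets as sets.

  comp-swap : comp u ≡ x → u ≡ comp x
  comp-swap {u} refl = sym (comp-involutive u)

  var-≡ : ∀ u x → var u ≡ var x → u ≡ x ⊎ u ≡ comp x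
  var-≡ (_ , true)  (_ , true)  refl = inj₁ refl
  var-≡ (_ , true)  (_ , false) refl = inj₂ refl
  var-≡ (_ , false) (_ , true)  refl = inj₂ refl
  var-≡ (_ , false) (_ , false) refl = inj₁ refl

  ∈-pos-neg : ∀ u → u ∈ (pos (var u) ∷ neg (var u) ∷ [])
  ∈-pos-neg (_ , true)  = here refl
  ∈-pos-neg (_ , false) = there (here refl)

  pos-neg-∈ : u ∈ (pos v ∷ neg v ∷ []) → var u ≡ v
  pos-neg-∈ (here refl)         = refl
  pos-neg-∈ (there (here refl)) = refl

  ≈ᴸ-refl : K ≈ᴸ K
  ≈ᴸ-refl = id , id

  ≈ᴸ-sym : K ≈ᴸ L → L ≈ᴸ K
  ≈ᴸ-sym (p , q) = q , p

  ≈ᴸ-trans : ∀ {M} → K ≈ᴸ L → L ≈ᴸ M → K ≈ᴸ M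
  ≈ᴸ-trans (p , q) (p′ , q′) = (λ z → p′ (p z)) , (λ z → q (q′ z))

  -- Unlike C ∈ᶜ F, this does not mention the consistency proof of the clause, so that the
  -- clause can be inferred; for a clause C, literals C ∈ˢ F is C ∈ᶜ F by definition.

  infix 4 _∈ˢ_

  _∈ˢ_ : List Literal → ClauseSet → Set
  K ∈ˢ F = Any (λ D → K ≈ᴸ literals D) F

  ∈ˢ-resp : K ≈ᴸ L → L ∈ˢ F → K ∈ˢ F
  ∈ˢ-resp p = Any.map (≈ᴸ-trans p)

  ∈⇒∈ˢ : D ≡Membership.∈ F → literals D ∈ˢ F
  ∈⇒∈ˢ = Any.map λ where refl → ≈ᴸ-refl

  ∈ˢ⇒∈ : K ∈ˢ F → ∃[ D ] (D ≡Membership.∈ F × K ≈ᴸ literals D)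
  ∈ˢ⇒∈ = ≡Membership.find

  ⊆ᶜ⇒ : F ⊆ᶜ G → K ∈ˢ F → K ∈ˢ G
  ⊆ᶜ⇒ F⊆G K∈F with ∈ˢ⇒∈ K∈F
  ... | D , D∈F , K≈D = ∈ˢ-resp K≈D (F⊆G {D} (∈⇒∈ˢ D∈F))

  ∈ˢ-consistent : K ∈ˢ F → u ∈ K → comp u ∉ K
  ∈ˢ-consistent K∈F u∈K ū∈K with ∈ˢ⇒∈ K∈F
  ... | D , _ , K⊆D , _ = consistent D (K⊆D u∈K) (K⊆D ū∈K)

  ∈-Vars⁺ : K ∈ˢ F → u ∈ K → var u ∈ⱽ Vars F
  ∈-Vars⁺ K∈F u∈K = ∈-concatMap⁺ vars (Any.map (λ (K⊆D , _) → ∈-map⁺ var (K⊆D u∈K)) K∈F)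

  ∈-Vars⁻ : v ∈ⱽ Vars F → ∃[ K ] (K ∈ˢ F × ∃[ u ] (u ∈ K × v ≡ var u))
  ∈-Vars⁻ p with ≡Membership.find (∈-concatMap⁻ vars p)
  ... | D , D∈F , q with ∈-map⁻ var q
  ... | u , u∈D , eq = literals D , ∈⇒∈ˢ D∈F , u , u∈D , eq

  ∈-remove⁺ : K ∈ˢ F → ¬ literals D ≈ᴸ K → K ∈ˢ remove D F
  ∈-remove⁺ {D = D} K∈F D≉K with ∈ˢ⇒∈ K∈F
  ... | E , E∈F , K≈E = ≡Membership.lose
    (∈-filter⁺ (λ E → ¬? (D ≈? E)) E∈F λ D≈E → D≉K (≈ᴸ-trans D≈E (≈ᴸ-sym K≈E))) K≈E

  ∈-remove⁻ : K ∈ˢ remove D F → K ∈ˢ F × ¬ literals D ≈ᴸ K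
  ∈-remove⁻ {D = D} p with ∈ˢ⇒∈ p
  ... | E , E∈ , K≈E with ∈-filter⁻ (λ E → ¬? (D ≈? E)) E∈
  ... | E∈F , D≉E = ≡Membership.lose E∈F K≈E , λ D≈K → D≉E (≈ᴸ-trans D≈K K≈E)

  -- Assignments.

  Holds : Assignment → Literal → Set
  Holds φ (v , b) = φ v ≡ b

  infix 4 _⊩_

  -- Satisfaction is needed for bare literal lists, since stripped or extended clauses come without
  -- a consistency proof.
  _⊩_ : Assignment → List Literal → Set
  φ ⊩ K = ∃[ u ] (u ∈ K × Holds φ u)

  ⊨⇒⊩ : φ ⊨ D → φ ⊩ literals D
  ⊨⇒⊩ = ≡Membership.find

  ⊩⇒⊨ : φ ⊩ literals D → φ ⊨ D
  ⊩⇒⊨ (u , u∈D , h) = ≡Membership.lose u∈D h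

  ⊩-mono : K ⊆ L → φ ⊩ K → φ ⊩ L
  ⊩-mono K⊆L (u , u∈K , h) = u , K⊆L u∈K , h

  allSat⁺ : (∀ {K} → K ∈ˢ F → φ ⊩ K) → All (φ ⊨_) F
  allSat⁺ f = All.tabulate λ {D} D∈F → ⊩⇒⊨ {D = D} (f (∈⇒∈ˢ D∈F))

  allSat⁻ : All (φ ⊨_) F → K ∈ˢ F → φ ⊩ K
  allSat⁻ all K∈F with ∈ˢ⇒∈ K∈F
  ... | D , D∈F , _ , D⊆K = ⊩-mono D⊆K (⊨⇒⊩ {D = D} (All.lookup all D∈F))

  holds-comp : ∀ u → ¬ Holds φ (comp u) → Holds φ u
  holds-comp (v , b) p = trans (Bool.¬-not p) (Bool.not-involutive b)

  ¬holds-comp : ∀ u → Holds φ u → ¬ Holds φ (comp u)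
  ¬holds-comp (v , true)  p q with () ← trans (sym p) q
  ¬holds-comp (v , false) p q with () ← trans (sym p) q

  infixl 5 _[_]

  _[_] : Assignment → Literal → Assignment
  (φ [ x ]) v with v ≟ⱽ var x
  ... | yes _ = proj₂ x
  ... | no  _ = φ v

  holds-updated : ∀ φ x → Holds (φ [ x ]) x
  holds-updated φ x with var x ≟ⱽ var x
  ... | yes _ = refl
  ... | no ≢  = ⊥-elim (≢ refl)

  holds-kept : ∀ u x → u ≢ comp x → Holds φ u → Holds (φ [ x ]) u
  holds-kept u x u≢x̄ h with var u ≟ⱽ var x
  ... | no _ = h
  ... | yes eq with var-≡ u x eq
  ... | inj₁ refl = refl
  ... | inj₂ u≡x̄  = ⊥-elim (u≢x̄ u≡x̄)

  -- Singular variables and literal degrees.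

  Occurs : ClauseSet → Literal → Set
  Occurs F x = ∃[ K ] (K ∈ˢ F × x ∈ K)

  OnlyIn : List Literal → ClauseSet → Literal → Set
  OnlyIn K F x = K ∈ˢ F × x ∈ K × (∀ {L} → L ∈ˢ F → x ∈ L → L ≈ᴸ K)

  -- A singular variable together with the sign that has degree one. `K` is its main clause; the
  -- clauses with `comp x` are its side clauses.
  Main : ClauseSet → Literal → Set
  Main F x = ∃[ K ] OnlyIn K F x × Occurs F (comp x)

  module _ (F : ClauseSet) (x : Literal) where

    private
      contains? : ∀ C → Dec (x ∈ literals C)
      contains? C = x ∈? literals C

      occurrences : ClauseSet
      occurrences = filter contains? (deduplicate _≈?_ F)

      ∈-occurrences⁺ : K ∈ˢ F → x ∈ K → K ∈ˢ occurrences
      ∈-occurrences⁺ K∈F x∈K with ∈ˢ⇒∈ K∈F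
      ... | C , C∈F , K≈C with ∈ˢ⇒∈ (SetoidMembership.∈-deduplicate⁺ clauseSetoid _≈?_
          (λ p q → ≈ᴸ-trans q (≈ᴸ-sym p)) {z = C} (∈⇒∈ˢ C∈F))
      ... | D , D∈ , C≈D = ∈ˢ-resp (≈ᴸ-trans K≈C C≈D)
        (∈⇒∈ˢ (∈-filter⁺ contains? D∈ (proj₁ C≈D (proj₁ K≈C x∈K))))

      ∈-occurrences⁻ : K ∈ˢ occurrences → K ∈ˢ F × x ∈ K
      ∈-occurrences⁻ p with ∈ˢ⇒∈ p
      ... | C , C∈ , K≈C with ∈-filter⁻ contains? C∈
      ... | q , x∈C =
          ∈ˢ-resp K≈C (SetoidMembership.∈-deduplicate⁻ clauseSetoid _≈?_ F {C} (∈⇒∈ˢ q))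
        , proj₂ K≈C x∈C

    ldeg≡1⇒OnlyIn : ldeg F x ≡ 1 → ∃[ K ] OnlyIn K F x
    -- The facts about `occurrences` are abstracted along with it, so that they follow the split on
    -- its shape.
    ldeg≡1⇒OnlyIn eq with occurrences | eq | (λ {K} → ∈-occurrences⁺ {K}) | (λ {K} → ∈-occurrences⁻ {K})
    ... | C ∷ [] | _ | occ⁺ | occ⁻ with occ⁻ (here ≈ᴸ-refl)
    ... | C∈F , x∈C = literals C , C∈F , x∈C , λ L∈F x∈L → only (occ⁺ L∈F x∈L)
      where
      only : L ∈ˢ (C ∷ []) → L ≈ᴸ literals C
      only (here p) = p

    ldeg≥1⇒Occurs : 1 ≤ ldeg F x → Occurs F x
    ldeg≥1⇒Occurs le with occurrences | le | (λ {K} → ∈-occurrences⁻ {K})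
    ... | C ∷ _ | _ | occ⁻ = literals C , occ⁻ (here ≈ᴸ-refl)

    Occurs⇒ldeg≥1 : Occurs F x → 1 ≤ ldeg F x
    Occurs⇒ldeg≥1 (K , K∈F , x∈K) with occurrences | ∈-occurrences⁺ K∈F x∈K
    ... | _ ∷ _ | _ = s≤s z≤n

    OnlyIn⇒ldeg≡1 : OnlyIn K F x → ldeg F x ≡ 1
    OnlyIn⇒ldeg≡1 (K∈F , x∈K , only)
      with occurrences | ∈-occurrences⁺ K∈F x∈K | (λ {K} → ∈-occurrences⁻ {K})
         | UniqueSetoid.filter⁺ clauseSetoid contains? (deduplicate-! clauseDecSetoid F)
    ... | _ ∷ []    | _ | _    | _ = refl
    -- Both clauses would equal `K`, but deduplication made them distinct.
    ... | D ∷ E ∷ _ | _ | occ⁻ | (D≉E ∷ _) ∷ _ =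
      let D∈F , x∈D = occ⁻ (here ≈ᴸ-refl)
          E∈F , x∈E = occ⁻ (there (here ≈ᴸ-refl))
      in ⊥-elim (D≉E (≈ᴸ-trans (only D∈F x∈D) (≈ᴸ-sym (only E∈F x∈E))))

  Singular⇒Main : ∀ F v → Singular F v → ∃[ x ] (v ≡ var x × Main F x)
  Singular⇒Main F v s with ⊓≡1 s
  ... | inj₁ (p , q) = let C , o = ldeg≡1⇒OnlyIn F (pos v) p in
    pos v , refl , C , o , ldeg≥1⇒Occurs F (neg v) q
  ... | inj₂ (p , q) = let C , o = ldeg≡1⇒OnlyIn F (neg v) p in
    neg v , refl , C , o , ldeg≥1⇒Occurs F (pos v) q

  Main⇒Singular : Main F x → Singular F (var x)
  Main⇒Singular {F} {v , true} (C , o , occ)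
    rewrite OnlyIn⇒ldeg≡1 F (pos v) o = ℕ.m≤n⇒m⊓n≡m (Occurs⇒ldeg≥1 F (neg v) occ)
  Main⇒Singular {F} {v , false} (C , o , occ)
    rewrite OnlyIn⇒ldeg≡1 F (neg v) o = ℕ.m≥n⇒m⊓n≡n (Occurs⇒ldeg≥1 F (pos v) occ)

  -- Set equality of clause-sets.

  infix 4 _≋ˢ_

  _≋ˢ_ : ClauseSet → ClauseSet → Set
  F ≋ˢ G = (∀ {K} → K ∈ˢ F → K ∈ˢ G) × (∀ {K} → K ∈ˢ G → K ∈ˢ F)

  ≋⇒≋ˢ : F ≋ G → F ≋ˢ G
  ≋⇒≋ˢ {F} {G} (F⊆G , G⊆F) = ⊆ᶜ⇒ {F} {G} (λ {D} → F⊆G {D}) , ⊆ᶜ⇒ {G} {F} (λ {D} → G⊆F {D})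

  ≋ˢ⇒≋ : F ≋ˢ G → F ≋ G
  ≋ˢ⇒≋ (F⊆G , G⊆F) = (λ p → F⊆G p) , λ p → G⊆F p

  ≋ˢ-sym : F ≋ˢ G → G ≋ˢ F
  ≋ˢ-sym (p , q) = q , p

  ≋ˢ-trans : F ≋ˢ G → G ≋ˢ H → F ≋ˢ H
  ≋ˢ-trans (p , q) (p′ , q′) = (λ z → p′ (p z)) , (λ z → q (q′ z))

  Main-resp : F ≋ˢ G → Main F x → Main G x
  Main-resp (F⊆G , G⊆F) (C , (C∈F , x∈C , only) , D , D∈F , x̄∈D) =
    C , (F⊆G C∈F , x∈C , (λ E∈G → only (G⊆F E∈G))) , D , F⊆G D∈F , x̄∈D

  Nonsingular-resp : F ≋ˢ G → Nonsingular F → Nonsingular G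
  Nonsingular-resp {G = G} F≋G ns v s with Singular⇒Main G v s
  ... | x , refl , m = ns (var x) (Main⇒Singular (Main-resp (≋ˢ-sym F≋G) m))

  -- Partial assignments.

  -- Opaque so that the arguments of strip can be inferred; in later blocks opacity keeps
  -- with-abstraction from unfolding proofs.
  opaque

    strip : Literal → List Literal → List Literal
    strip y K = K ∖ (y ∷ [])

    ∈-strip⁺ : u ∈ K → u ≢ y → u ∈ strip y K
    ∈-strip⁺ {y = y} u∈K u≢y = ∈-filter⁺ (λ u → ¬? (u ∈? (y ∷ []))) u∈K λ where (here eq) → u≢y eq

    ∈-strip⁻ : u ∈ strip y K → u ∈ K × u ≢ y
    ∈-strip⁻ {y = y} {K = K} p with ∈-filter⁻ (λ u → ¬? (u ∈? (y ∷ []))) {xs = K} p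
    ... | u∈K , u∉y = u∈K , λ eq → u∉y (here eq)

  strip-mono : K ⊆ L → strip y K ⊆ strip y L
  strip-mono K⊆L p with ∈-strip⁻ p
  ... | u∈K , u≢y = ∈-strip⁺ (K⊆L u∈K) u≢y

  strip-cong : K ≈ᴸ L → strip y K ≈ᴸ strip y L
  strip-cong (p , q) = strip-mono p , strip-mono q

  strip-comm : strip x (strip y K) ⊆ strip y (strip x K)
  strip-comm p with ∈-strip⁻ p
  ... | q , u≢x with ∈-strip⁻ q
  ... | u∈K , u≢y = ∈-strip⁺ (∈-strip⁺ u∈K u≢x) u≢y

  -- G is F under the partial assignment that makes x true.
  Reduct : ClauseSet → Literal → ClauseSet → Set
  Reduct F x G =
      (∀ {K} → K ∈ˢ G → ∃[ L ] (L ∈ˢ F × x ∉ L × K ≈ᴸ strip (comp x) L))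
    × (∀ {L} → L ∈ˢ F → x ∉ L → strip (comp x) L ∈ˢ G)

  Reduct-resp : ∀ {F′ G′} → F ≋ˢ F′ → Reduct F x G → Reduct F′ x G′ → G ≋ˢ G′
  Reduct-resp (F⊆F′ , F′⊆F) r r′ = half F⊆F′ r r′ , half F′⊆F r′ r
    where
    half : ∀ {F F′ G G′} → (∀ {K} → K ∈ˢ F → K ∈ˢ F′) → Reduct F x G → Reduct F′ x G′ →
      K ∈ˢ G → K ∈ˢ G′
    half F⊆F′ (r , _) (_ , r′) K∈G with r K∈G
    ... | L , L∈F , x∉L , K≈ = ∈ˢ-resp K≈ (r′ (F⊆F′ L∈F) x∉L)

  -- A clause survives both reductions, in either order, exactly if it contains neither `x` nor `y`:
  -- as the variables differ, stripping for one literal cannot delete the other. The two strippings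
  -- commute.
  Reduct-comm : ∀ {A A′ B B′} → var x ≢ var y →
    Reduct F x A → Reduct A y A′ → Reduct F y B → Reduct B x B′ → A′ ≋ˢ B′
  Reduct-comm x≢y rA rA′ rB rB′ = half x≢y rA rA′ rB rB′ , half (x≢y ∘ sym) rB rB′ rA rA′
    where
    half : ∀ {x y A A′ B B′} → var x ≢ var y →
      Reduct F x A → Reduct A y A′ → Reduct F y B → Reduct B x B′ → K ∈ˢ A′ → K ∈ˢ B′
    half x≢y (rA , _) (rA′ , _) (_ , rB) (_ , rB′) K∈A′ with rA′ K∈A′
    ... | L , L∈A , y∉L , K≈ with rA L∈A
    ... | M , M∈F , x∉M , L≈ = ∈ˢ-resp
      (≈ᴸ-trans K≈ (≈ᴸ-trans (strip-cong L≈) (strip-comm , strip-comm)))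
      (rB′ (rB M∈F λ y∈M → y∉L (proj₂ L≈ (∈-strip⁺ y∈M λ y≡x̄ → x≢y (sym (cong var y≡x̄)))))
           (x∉M ∘ proj₁ ∘ ∈-strip⁻))

  -- Models of all clauses but one.

  -- Otherwise `φ` would be a model of `F`. Contradictions below are mostly reached in this form.
  unsat-refill : Unsatisfiable F → φ ⊩ K → ¬ (∀ {L} → L ∈ˢ F → ¬ K ≈ᴸ L → φ ⊩ L)
  unsat-refill {F} {φ} {K} unsat φ⊩K others = unsat (φ , allSat⁺ sat)
    where
    sat : L ∈ˢ F → φ ⊩ L
    sat {L} L∈F with K ≈ᴸ? L
    ... | yes (K⊆L , _) = ⊩-mono K⊆L φ⊩K
    ... | no K≉L        = others L∈F K≉L

  opaque

    MU-removal : MU F → K ∈ˢ F → ∃[ φ ] (∀ {L} → L ∈ˢ F → ¬ K ≈ᴸ L → φ ⊩ L)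
    MU-removal {F} (unsat , minimal) K∈F with ∈ˢ⇒∈ K∈F
    ... | D , D∈F , K≈D with minimal {remove D F} (λ p → proj₁ (∈-remove⁻ {D = D} {F = F} p))
        (λ F⊆ → proj₂ (∈-remove⁻ {D = D} {F = F} (F⊆ {D} (∈⇒∈ˢ D∈F))) ≈ᴸ-refl)
    ... | φ , all = φ , λ L∈F K≉L →
      allSat⁻ all (∈-remove⁺ {D = D} L∈F λ D≈L → K≉L (≈ᴸ-trans K≈D D≈L))

  opaque

    -- Saturation for any literal list equal to a clause, with the model's effect on the enlarged
    -- clause and on the other clauses separated.
    saturation : SaturatedMU F → K ∈ˢ F → var u ∈ⱽ Vars F → var u ∉ⱽ map var K →
      ∃[ φ ] (φ ⊩ u ∷ K × (∀ {L} → L ∈ˢ F → ¬ K ≈ᴸ L → φ ⊩ L))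
    saturation {F} {K} {u} (_ , sat) K∈F u∈F u∉K with ∈ˢ⇒∈ K∈F
    ... | D , D∈F , K⊆D , D⊆K with sat {D} {u} (∈⇒∈ˢ D∈F) u∈F u∉D
      where
      u∉D : var u ∉ⱽ vars D
      u∉D p with ∈-map⁻ var p
      ... | z , z∈D , eq = u∉K (subst (_∈ⱽ map var K) (sym eq) (∈-map⁺ var (D⊆K z∈D)))
    ... | φ , all = φ
      , ⊩-mono (λ where
          (here eq) → here eq
          (there p) → there (D⊆K p)) (allSat⁻ all (here ≈ᴸ-refl))
      , λ L∈F K≉L → allSat⁻ all (there
          (∈-remove⁺ {D = D} L∈F λ D≈L → K≉L (≈ᴸ-trans (K⊆D , D⊆K) D≈L)))

  -- Reducts of a saturated clause-set at a literal with one occurrence.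

  module _ {F x C} (satF : SaturatedMU F) (onlyC : OnlyIn C F x) where

    private
      unsatF : Unsatisfiable F
      unsatF = proj₁ (proj₁ satF)

    -- Making x false keeps the main clause C satisfied by u and satisfies every clause that
    -- contains the complement of x.
    main-literal-fails : K ∈ˢ F → comp x ∈ K → u ∈ C → u ≢ x → Holds φ u →
      ¬ (∀ {L} → L ∈ˢ F → ¬ K ≈ᴸ L → φ ⊩ L)
    main-literal-fails {K} {u} {φ} K∈F x̄∈K u∈C u≢x φu others =
      unsat-refill unsatF (comp x , x̄∈K , holds-updated φ (comp x)) sat
      where
      keep : ∀ {z} → z ≢ x → Holds φ z → Holds (φ [ comp x ]) z
      keep {z} z≢x = holds-kept z (comp x) (λ eq → z≢x (trans eq (comp-involutive x)))

      sat : L ∈ˢ F → ¬ K ≈ᴸ L → φ [ comp x ] ⊩ L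
      sat L∈F K≉L with others L∈F K≉L
      ... | z , z∈L , φz with z ≟ᴸ x
      ... | no z≢x  = z , z∈L , keep z≢x φz
      ... | yes refl = u , proj₂ (proj₂ (proj₂ onlyC) L∈F z∈L) u∈C , keep u≢x φu

    opaque

      -- Suppose `u` is missing from the side clause `K`. If `comp u` is in `K`, a model of the
      -- other clauses falsifies `K` and so makes `u` true. If the variable of `u` is absent from
      -- `K`, saturation gives a model of the other clauses and of `K` with `u` added; since `K`
      -- itself must fail, again `u` is true. Both contradict `main-literal-fails`.
      main⊆side : K ∈ˢ F → comp x ∈ K → u ∈ C → u ≢ x → u ∈ K
      main⊆side {K} {u} K∈F x̄∈K u∈C u≢x with u ∈? K | comp u ∈? K
      ... | yes u∈K | _ = u∈K
      ... | no _ | yes ū∈K with MU-removal (proj₁ satF) K∈F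
      ... | φ , others = ⊥-elim (main-literal-fails K∈F x̄∈K u∈C u≢x
        (holds-comp {φ} u λ h → unsat-refill unsatF (comp u , ū∈K , h) others) others)
      main⊆side {K} {u} K∈F x̄∈K u∈C u≢x | no u∉K | no ū∉K
        with saturation satF K∈F (∈-Vars⁺ (proj₁ onlyC) u∈C) var∉
        where
        var∉ : var u ∉ⱽ map var K
        var∉ p with ∈-map⁻ var p
        ... | z , z∈K , eq with var-≡ z u (sym eq)
        ... | inj₁ refl = u∉K z∈K
        ... | inj₂ refl = ū∉K z∈K
      ... | φ , (_ , here refl , φu) , others =
        ⊥-elim (main-literal-fails K∈F x̄∈K u∈C u≢x φu others)
      ... | φ , (z , there z∈K , φz) , others =
        ⊥-elim (unsat-refill unsatF (z , z∈K , φz) others)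

    -- If φ makes x false, then C has another true literal, which lies in every side clause.
    satisfies-strip : φ ⊩ C → x ∉ K → (comp x ∈ K → ∀ {u} → u ∈ C → u ≢ x → u ∈ K) →
      φ ⊩ K → φ [ x ] ⊩ strip (comp x) K
    satisfies-strip {φ} (z , z∈C , φz) x∉K C⊆K (u , u∈K , φu) with u ≟ᴸ comp x
    ... | no u≢x̄ = u , ∈-strip⁺ u∈K u≢x̄ , holds-kept u x u≢x̄ φu
    ... | yes refl = z , ∈-strip⁺ (C⊆K u∈K z∈C z≢x) z≢x̄ , holds-kept z x z≢x̄ φz
      where
      z≢x : z ≢ x
      z≢x refl = ¬holds-comp {φ} z φz φu
      z≢x̄ : z ≢ comp x
      z≢x̄ refl = ∈ˢ-consistent (proj₁ onlyC) (proj₁ (proj₂ onlyC)) z∈C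

    module _ {G} (red : Reduct F x G) where

      private
        -- Clauses with different strippings are different, so `φ` satisfies the origin of every
        -- clause of `G` other than `E`. It satisfies `C` too, because `x` is in `C` but not in `K`;
        -- this is what `satisfies-strip` requires.
        satisfies-others : ∀ {E} → x ∉ K → E ≈ᴸ strip (comp x) K →
          (∀ {L} → L ∈ˢ F → ¬ K ≈ᴸ L → φ ⊩ L) →
          L ∈ˢ G → ¬ E ≈ᴸ L → φ [ x ] ⊩ L
        satisfies-others x∉K E≈ others L∈G E≉L with proj₁ red L∈G
        ... | M , M∈F , x∉M , L≈@(_ , M⊆L) = ⊩-mono M⊆L (satisfies-strip
          (others (proj₁ onlyC) λ (_ , C⊆K) → x∉K (C⊆K (proj₁ (proj₂ onlyC))))
          x∉M (λ x̄∈M → main⊆side M∈F x̄∈M)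
          (others M∈F λ K≈M → E≉L (≈ᴸ-trans E≈ (≈ᴸ-trans (strip-cong K≈M) (≈ᴸ-sym L≈)))))

      -- A model of `G`, changed to make `x` true, would be a model of `F`.
      Reduct-unsatisfiable : Unsatisfiable G
      Reduct-unsatisfiable (φ , all) = unsatF (φ [ x ] , allSat⁺ sat)
        where
        sat : L ∈ˢ F → φ [ x ] ⊩ L
        sat {L} L∈F with x ∈? L
        ... | yes x∈L = x , x∈L , holds-updated φ x
        ... | no x∉L with allSat⁻ all (proj₂ red L∈F x∉L)
        ... | u , u∈ , φu with ∈-strip⁻ u∈
        ... | u∈L , u≢x̄ = u , u∈L , holds-kept u x u≢x̄ φu

      -- A clause `E` missing from `H` stems from a clause `K` of `F`; a model of `F` without `K`,
      -- with `x` made true, satisfies `H`.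
      Reduct-MU : MU G
      Reduct-MU = Reduct-unsatisfiable , minimal
        where
        minimal : H ⊆ᶜ G → ¬ (G ⊆ᶜ H) → Satisfiable H
        minimal {H} H⊆G G⊈H with All.all? (_∈ᶜ? H) G
        ... | yes all = ⊥-elim (G⊈H λ {D} D∈G → let E , E∈G , D≈E = ∈ˢ⇒∈ D∈G in
          ∈ˢ-resp D≈E (All.lookup all E∈G))
        ... | no ¬all with ≡Membership.find (¬All⇒Any¬ (_∈ᶜ? H) G ¬all)
        ... | E , E∈G , E∉H with proj₁ red (∈⇒∈ˢ E∈G)
        ... | K , K∈F , x∉K , E≈ with MU-removal (proj₁ satF) K∈F
        ... | φ , others = φ [ x ] , allSat⁺ λ L∈H → satisfies-others x∉K E≈ others
          (⊆ᶜ⇒ {H} {G} (λ {D} → H⊆G {D}) L∈H) (λ E≈L → E∉H (∈ˢ-resp E≈L L∈H))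

      Reduct-var∉ : var x ∉ⱽ Vars G
      Reduct-var∉ p with ∈-Vars⁻ p
      ... | K , K∈G , u , u∈K , eq with proj₁ red K∈G
      ... | L , L∈F , x∉L , K⊆L , _ with ∈-strip⁻ (K⊆L u∈K) | var-≡ u x (sym eq)
      ... | u∈L , _ | inj₁ refl = x∉L u∈L
      ... | _ , u≢x̄ | inj₂ u≡x̄  = u≢x̄ u≡x̄

      Reduct-Vars⊆ : v ∈ⱽ Vars G → v ∈ⱽ Vars F
      Reduct-Vars⊆ p with ∈-Vars⁻ p
      ... | K , K∈G , u , u∈K , refl with proj₁ red K∈G
      ... | L , L∈F , x∉L , K⊆L , _ = ∈-Vars⁺ L∈F (proj₁ (∈-strip⁻ (K⊆L u∈K)))

      opaque

        -- The clause `E` to be enlarged by `u` stems from some `K` in `F`. Saturation of `F` at `K`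
        -- and `u` gives a model, and making `x` true in it yields the one for `G`.
        Reduct-SaturatedMU : SaturatedMU G
        Reduct-SaturatedMU = Reduct-MU , λ {E} {u} → saturated E u
          where
          saturated : ∀ E u → E ∈ᶜ G → var u ∈ⱽ Vars G → (u∉ : var u ∉ⱽ vars E) →
            Satisfiable (adjoin E u u∉ ∷ remove E G)
          saturated E u E∈G u∈G u∉E with proj₁ red E∈G
          ... | K , K∈F , x∉K , E≈@(_ , K⊆E)
              with saturation satF K∈F (Reduct-Vars⊆ u∈G) u∉K
            where
            u∉K : var u ∉ⱽ map var K
            u∉K p with ∈-map⁻ var p
            ... | z , z∈K , eq with z ≟ᴸ comp x
            ... | no z≢x̄ = u∉E (subst (_∈ⱽ vars E) (sym eq) (∈-map⁺ var (K⊆E (∈-strip⁺ z∈K z≢x̄))))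
            -- The stripped literal cannot share its variable with `u`, since that variable no
            -- longer occurs in `G`.
            ... | yes refl = Reduct-var∉ (subst (_∈ⱽ Vars G) eq u∈G)
          ... | φ , φ⊩uK , others = φ [ x ]
            , ⊩⇒⊨ {D = adjoin E u u∉E} (⊩-mono into (satisfies-strip φ⊩C x∉uK C⊆uK φ⊩uK))
            ∷ allSat⁺ λ L∈ → let L∈G , E≉L = ∈-remove⁻ {D = E} {F = G} L∈ in
                satisfies-others x∉K E≈ others L∈G E≉L
            where
            φ⊩C : φ ⊩ C
            φ⊩C = others (proj₁ onlyC) λ (_ , C⊆K) → x∉K (C⊆K (proj₁ (proj₂ onlyC)))
            x∉uK : x ∉ u ∷ K
            x∉uK (here refl) = Reduct-var∉ u∈G
            x∉uK (there x∈K) = x∉K x∈K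
            C⊆uK : comp x ∈ u ∷ K → ∀ {z} → z ∈ C → z ≢ x → z ∈ u ∷ K
            C⊆uK (here refl)  = ⊥-elim (Reduct-var∉ u∈G)
            C⊆uK (there x̄∈K) z∈C z≢x = there (main⊆side K∈F x̄∈K z∈C z≢x)
            into : strip (comp x) (u ∷ K) ⊆ u ∷ literals E
            into p with ∈-strip⁻ p
            ... | here eq , _     = here eq
            ... | there z∈K , z≢x̄ = there (K⊆E (∈-strip⁺ z∈K z≢x̄))

      opaque

        -- The main clause of `y` avoids `x`, so it survives, and stripping creates no new
        -- occurrence of `y`. An occurrence of `comp y` survives as well, if need be in a side
        -- clause of `x`.
        Reduct-Main : Occurs F (comp x) → var x ≢ var y → Main F y → Main G y
        Reduct-Main {y} (S , S∈F , x̄∈S) x≢y (K , (K∈F , y∈K , onlyK) , T , T∈F , ȳ∈T) =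
          strip (comp x) K
          , ( proj₂ red K∈F x∉K , ∈-strip⁺ y∈K (λ eq → x≢y (sym (cong var eq)))
            , λ L∈G y∈L → let M , M∈F , _ , L≈ = proj₁ red L∈G in
                ≈ᴸ-trans L≈ (strip-cong (onlyK M∈F (proj₁ (∈-strip⁻ (proj₁ L≈ y∈L))))))
          , occ
          where
          x∉S : x ∉ S
          x∉S x∈S = ∈ˢ-consistent S∈F x∈S x̄∈S

          -- If `x` were in `K`, then `K` would equal `C`, and `y` would pass from `C` into the side
          -- clause `S`. So `S` would equal `K` and contain both `x` and `comp x`.
          x∉K : x ∉ K
          x∉K x∈K = x∉S (proj₂ (onlyK S∈F y∈S) x∈K)
            where
            y∈S : y ∈ S
            y∈S = main⊆side S∈F x̄∈S (proj₁ (proj₂ (proj₂ onlyC) K∈F x∈K) y∈K)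
              λ eq → x≢y (sym (cong var eq))

          occurs-in : L ∈ˢ F → x ∉ L → comp y ∈ L → Occurs G (comp y)
          occurs-in L∈F x∉L ȳ∈L = _ , proj₂ red L∈F x∉L , ∈-strip⁺ ȳ∈L (λ eq → x≢y (sym (cong var eq)))

          occ : Occurs G (comp y)
          occ with x ∈? T
          ... | no x∉T  = occurs-in T∈F x∉T ȳ∈T
          -- Here `T` is the main clause `C`, which disappears; its literal `comp y` also lies in
          -- the side clause `S`.
          ... | yes x∈T = occurs-in S∈F x∉S (main⊆side S∈F x̄∈S
            (proj₁ (proj₂ (proj₂ onlyC) T∈F x∈T) ȳ∈T) λ eq → x≢y (sym (cong var eq)))

  -- DP-reduction as a partial assignment.

  ∈-map-comp⁺ : comp u ∈ K → u ∈ map comp K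
  ∈-map-comp⁺ {u} {K} p = subst (_∈ map comp K) (comp-involutive u) (∈-map⁺ comp p)

  ∈-map-comp⁻ : u ∈ map comp K → comp u ∈ K
  ∈-map-comp⁻ {K = K} p with ∈-map⁻ comp p
  ... | z , z∈K , refl = subst (_∈ K) (sym (comp-involutive z)) z∈K

  Resolvable⁺ : ∀ C D → pos v ∈ literals C → neg v ∈ literals D →
    (∀ {u} → u ∈ literals C → comp u ∈ literals D → u ≡ pos v) → Resolvable v C D
  Resolvable⁺ C D v∈C v̄∈D only =
      (λ p → let u∈C , u∈D̄ = ∈-filter⁻ (_∈? map comp (literals D)) {xs = literals C} p in
        here (only u∈C (∈-map-comp⁻ u∈D̄)))
    , λ where (here refl) → ∈-filter⁺ (_∈? map comp (literals D)) v∈C (∈-map-comp⁺ v̄∈D)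

  Resolvable⁻ : ∀ C D → Resolvable v C D → pos v ∈ literals C × neg v ∈ literals D
  Resolvable⁻ C D (_ , v∈) =
    let v∈C , v∈D̄ = ∈-filter⁻ (_∈? map comp (literals D)) {xs = literals C} (v∈ (here refl)) in
    v∈C , ∈-map-comp⁻ v∈D̄

  opaque

    -- The literals of `resolvent`, freed from the proof of resolvability; the two agree by
    -- computation once this is unfolded.
    resolventLiterals : V → List Literal → List Literal → List Literal
    resolventLiterals v K L = K ∪ L ∖ (pos v ∷ neg v ∷ [])

    ∈-resolvent⁺ : u ∈ K ⊎ u ∈ L → var u ≢ v → u ∈ resolventLiterals v K L
    ∈-resolvent⁺ {K = K} {v = v} u∈ u≢v =
      ∈-filter⁺ (λ u → ¬? (u ∈? (pos v ∷ neg v ∷ []))) (join u∈) (u≢v ∘ pos-neg-∈)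
      where
      join : u ∈ K ⊎ u ∈ L → u ∈ K ∪ L
      join (inj₁ p) = ∈-++⁺ˡ p
      join (inj₂ p) = ∈-++⁺ʳ _ p

    ∈-resolvent⁻ : u ∈ resolventLiterals v K L → (u ∈ K ⊎ u ∈ L) × var u ≢ v
    ∈-resolvent⁻ {u} {v} {K} {L} p
      with ∈-filter⁻ (λ u → ¬? (u ∈? (pos v ∷ neg v ∷ []))) {xs = K ∪ L} p
    ... | q , u∉ = ∈-++⁻ K q , λ where refl → u∉ (∈-pos-neg u)

  module _ (v : V) (F : ClauseSet) where

    private
      resolve : Clause × Clause → Maybe Clause
      resolve (C , D) = Maybe.map (resolvent v C D) (dec⇒maybe (resolvable? v C D))

      opaque
        unfolding resolventLiterals

        resolve⁺ : ∀ C D → Resolvable v C D →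
          MAny.Any (λ E → resolventLiterals v (literals C) (literals D) ≈ᴸ literals E) (resolve (C , D))
        resolve⁺ C D r with resolvable? v C D
        ... | yes _ = MAny.just ≈ᴸ-refl
        ... | no ¬r = ⊥-elim (¬r r)

        resolve⁻ : ∀ C D → MAny.Any (λ E → K ≈ᴸ literals E) (resolve (C , D)) →
          Resolvable v C D × K ≈ᴸ resolventLiterals v (literals C) (literals D)
        resolve⁻ C D p with resolvable? v C D | p
        ... | yes r | MAny.just K≈ = r , K≈

    ∈-DP-keep : K ∈ˢ F → v ∉ⱽ map var K → K ∈ˢ DP v F
    ∈-DP-keep K∈F v∉K with ∈ˢ⇒∈ K∈F
    ... | D , D∈F , K≈D@(_ , D⊆K) = ≡Membership.lose
      (∈-++⁺ˡ (∈-filter⁺ (λ C → v ∉ⱽ? vars C) D∈F v∉D)) K≈D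
      where
      v∉D : v ∉ⱽ vars D
      v∉D p with ∈-map⁻ var p
      ... | z , z∈D , refl = v∉K (∈-map⁺ var (D⊆K z∈D))

    ∈-DP-resolvent : ∀ {C D} → C ≡Membership.∈ F → D ≡Membership.∈ F → Resolvable v C D →
      resolventLiterals v (literals C) (literals D) ∈ˢ DP v F
    ∈-DP-resolvent {C} {D} C∈F D∈F r = Any.++⁺ʳ (filter (λ C → v ∉ⱽ? vars C) F)
      (Any.mapMaybe⁺ resolve (cartesianProduct F F)
        (Any.map⁺ (≡Membership.lose (∈-cartesianProduct⁺ C∈F D∈F) (resolve⁺ C D r))))

    opaque

      ∈-DP⁻ : K ∈ˢ DP v F → (K ∈ˢ F × v ∉ⱽ map var K)
        ⊎ ∃[ C ] ∃[ D ] (literals C ∈ˢ F × literals D ∈ˢ F × Resolvable v C D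
            × K ≈ᴸ resolventLiterals v (literals C) (literals D))
      ∈-DP⁻ {K} p with Any.++⁻ (filter (λ C → v ∉ⱽ? vars C) F) p
      ... | inj₁ q with ∈ˢ⇒∈ q
      ... | D , D∈ , K≈D@(K⊆D , _) with ∈-filter⁻ (λ C → v ∉ⱽ? vars C) D∈
      ... | D∈F , v∉D = inj₁ (≡Membership.lose D∈F K≈D , v∉K)
        where
        v∉K : v ∉ⱽ map var K
        v∉K p with ∈-map⁻ var p
        ... | z , z∈K , refl = v∉D (∈-map⁺ var (K⊆D z∈K))
      ∈-DP⁻ p | inj₂ q with ≡Membership.find (mapMaybe⁻ resolve (cartesianProduct F F) q)
      ... | (C , D) , CD∈ , m with ∈-cartesianProduct⁻ F F CD∈ | resolve⁻ C D m
      ... | C∈F , D∈F | r , K≈ = inj₂ (C , D , ∈⇒∈ˢ C∈F , ∈⇒∈ˢ D∈F , r , K≈)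

  opaque

    -- By `main⊆side` a side clause absorbs all literals of `C` except `x`, so their resolvent is
    -- the side clause without `comp x`. Clauses free of the variable are kept, and stripping does
    -- not change them.
    DP-Reduct : SaturatedMU F → Main F x → Reduct F x (DP (var x) F)
    DP-Reduct {F} {x} satF (C , onlyC@(C∈F , x∈C , only) , _) = to , from
      where
      resolvent⊆strip : L ∈ˢ F → comp x ∈ L → u ∈ C ⊎ u ∈ L → var u ≢ var x → u ∈ strip (comp x) L
      resolvent⊆strip L∈F x̄∈L (inj₁ u∈C) u≢v = ∈-strip⁺
        (main⊆side satF onlyC L∈F x̄∈L u∈C (u≢v ∘ cong var)) (u≢v ∘ cong var)
      resolvent⊆strip L∈F x̄∈L (inj₂ u∈L) u≢v = ∈-strip⁺ u∈L (u≢v ∘ cong var)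

      strip-var : x ∉ L → u ∈ strip (comp x) L → u ∈ L × var u ≢ var x
      strip-var {u = u} x∉L p with ∈-strip⁻ p
      ... | u∈L , u≢x̄ = u∈L , λ eq → Sum.[ (λ where refl → x∉L u∈L) , u≢x̄ ] (var-≡ u x eq)

      side∌x : L ∈ˢ F → comp x ∈ L → x ∉ L
      side∌x L∈F x̄∈L x∈L = ∈ˢ-consistent L∈F x∈L x̄∈L

      to : K ∈ˢ DP (var x) F → ∃[ L ] (L ∈ˢ F × x ∉ L × K ≈ᴸ strip (comp x) L)
      to {K} p with ∈-DP⁻ (var x) F p
      ... | inj₁ (K∈F , v∉K) = K , K∈F , v∉K ∘ ∈-map⁺ var
        , (λ u∈K → ∈-strip⁺ u∈K λ where refl → v∉K (∈-map⁺ var u∈K)) , proj₁ ∘ ∈-strip⁻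
      -- `Resolvable` puts the clause with the positive literal first, so the sign of `x` decides
      -- which parent is the main clause.
      ... | inj₂ (A , B , A∈F , B∈F , r , K⊆ , ⊆K) = side x refl
        where
        side : ∀ y → y ≡ x → ∃[ L ] (L ∈ˢ F × x ∉ L × K ≈ᴸ strip (comp x) L)
        side (_ , true) refl = let x∈A , x̄∈B = Resolvable⁻ A B r in
          literals B , B∈F , side∌x B∈F x̄∈B
          , (λ p → let u∈ , u≢v = ∈-resolvent⁻ (K⊆ p) in
              resolvent⊆strip B∈F x̄∈B (Sum.map₁ (proj₁ (only A∈F x∈A)) u∈) u≢v)
          , λ p → let u∈B , u≢v = strip-var (side∌x B∈F x̄∈B) p in ⊆K (∈-resolvent⁺ (inj₂ u∈B) u≢v)
        side (_ , false) refl = let x̄∈A , x∈B = Resolvable⁻ A B r in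
          literals A , A∈F , side∌x A∈F x̄∈A
          , (λ p → let u∈ , u≢v = ∈-resolvent⁻ (K⊆ p) in
              resolvent⊆strip A∈F x̄∈A (Sum.map₁ (proj₁ (only B∈F x∈B)) (swap u∈)) u≢v)
          , λ p → let u∈A , u≢v = strip-var (side∌x A∈F x̄∈A) p in ⊆K (∈-resolvent⁺ (inj₁ u∈A) u≢v)

      from : L ∈ˢ F → x ∉ L → strip (comp x) L ∈ˢ DP (var x) F
      from {L} L∈F x∉L with comp x ∈? L
      ... | no x̄∉L = ∈ˢ-resp (proj₁ ∘ ∈-strip⁻ , λ u∈L → ∈-strip⁺ u∈L λ where refl → x̄∉L u∈L)
        (∈-DP-keep (var x) F L∈F v∉L)
        where
        v∉L : var x ∉ⱽ map var L
        v∉L p with ∈-map⁻ var p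
        ... | u , u∈L , eq with var-≡ u x (sym eq)
        ... | inj₁ refl = x∉L u∈L
        ... | inj₂ refl = x̄∉L u∈L
      ... | yes x̄∈L with ∈ˢ⇒∈ C∈F | ∈ˢ⇒∈ L∈F
      ... | A , A∈F , C⊆A , A⊆C | B , B∈F , L⊆B , B⊆L = resolve x refl
        where
        -- Resolution needs a single clash. Any other literal of `C` lies in `L`, which then cannot
        -- contain its complement.
        clash : u ∈ C → comp u ∈ L → u ≡ x
        clash {u} u∈C ū∈L with u ≟ᴸ x
        ... | yes eq = eq
        ... | no u≢x = ⊥-elim (∈ˢ-consistent L∈F (main⊆side satF onlyC L∈F x̄∈L u∈C u≢x) ū∈L)

        resolve : ∀ y → y ≡ x → strip (comp x) L ∈ˢ DP (var x) F
        resolve (_ , true) refl = ∈ˢ-resp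
          ( (λ p → let u∈L , u≢v = strip-var x∉L p in ∈-resolvent⁺ (inj₂ (L⊆B u∈L)) u≢v)
          , λ p → let u∈ , u≢v = ∈-resolvent⁻ p in
              resolvent⊆strip L∈F x̄∈L (Sum.map A⊆C B⊆L u∈) u≢v)
          (∈-DP-resolvent (var x) F A∈F B∈F (Resolvable⁺ A B (C⊆A x∈C) (L⊆B x̄∈L)
            λ u∈A ū∈B → clash (A⊆C u∈A) (B⊆L ū∈B)))
        resolve (_ , false) refl = ∈ˢ-resp
          ( (λ p → let u∈L , u≢v = strip-var x∉L p in ∈-resolvent⁺ (inj₁ (L⊆B u∈L)) u≢v)
          , λ p → let u∈ , u≢v = ∈-resolvent⁻ p in
              resolvent⊆strip L∈F x̄∈L (swap (Sum.map B⊆L A⊆C u∈)) u≢v)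
          (∈-DP-resolvent (var x) F B∈F A∈F (Resolvable⁺ B A (L⊆B x̄∈L) (C⊆A x∈C)
            λ {u} u∈B ū∈A → comp-swap
              (clash (A⊆C ū∈A) (subst (_∈ L) (sym (comp-involutive u)) (B⊆L u∈B)))))

  -- Confluence.

  DP-SaturatedMU : SaturatedMU F → Main F x → SaturatedMU (DP (var x) F)
  DP-SaturatedMU satF m@(_ , onlyC , _) = Reduct-SaturatedMU satF onlyC (DP-Reduct satF m)

  DP-Main : SaturatedMU F → Main F x → var x ≢ var y → Main F y → Main (DP (var x) F) y
  DP-Main satF m@(_ , onlyC , occ) = Reduct-Main satF onlyC (DP-Reduct satF m) occ

  DP-resp : F ≋ˢ G → SaturatedMU F → SaturatedMU G → Main F x → DP (var x) F ≋ˢ DP (var x) G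
  DP-resp F≋G satF satG m =
    Reduct-resp F≋G (DP-Reduct satF m) (DP-Reduct satG (Main-resp F≋G m))

  DP-comm : SaturatedMU F → Main F x → Main F y → var x ≢ var y →
    DP (var y) (DP (var x) F) ≋ˢ DP (var x) (DP (var y) F)
  DP-comm satF mx my x≢y = Reduct-comm x≢y
    (DP-Reduct satF mx) (DP-Reduct (DP-SaturatedMU satF mx) (DP-Main satF mx x≢y my))
    (DP-Reduct satF my) (DP-Reduct (DP-SaturatedMU satF my) (DP-Main satF my (x≢y ∘ sym) mx))

  opaque

    -- Commuted steps give lists that need agree only as sets; this transports the remaining steps
    -- from one to the other.
    ⇝*-resp : F ≋ˢ G → SaturatedMU F → SaturatedMU G → F ⇝* H → ∃[ H′ ] (G ⇝* H′ × H ≋ˢ H′)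
    ⇝*-resp F≋G satF satG ε = _ , ε , F≋G
    ⇝*-resp {F} F≋G satF satG (sDP-step {v} _ s ◅ steps) with Singular⇒Main F v s
    ... | x , refl , m with ⇝*-resp (DP-resp F≋G satF satG m)
        (DP-SaturatedMU satF m) (DP-SaturatedMU satG (Main-resp F≋G m)) steps
    ... | H′ , steps′ , H≋H′ =
      H′ , sDP-step {v = var x} (proj₁ satG) (Main⇒Singular (Main-resp F≋G m)) ◅ steps′ , H≋H′

  opaque

    -- The variable of `x` stays singular until it is reduced, so a reduction ending in a
    -- nonsingular `H` must reduce it. That step is moved forward past one earlier step at a time by
    -- `DP-comm`.
    step-first : SaturatedMU F → Main F x → F ⇝* H → Nonsingular H →
      ∃[ H′ ] (DP (var x) F ⇝* H′ × H ≋ˢ H′)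
    step-first {x = x} satF mx ε ns = ⊥-elim (ns (var x) (Main⇒Singular mx))
    step-first {F} {x} {H} satF mx (sDP-step {v} _ s ◅ steps) ns with Singular⇒Main F v s
    ... | y , refl , my with var x ≟ⱽ var y
    -- The literals may have opposite signs, but `DP` depends only on the variable.
    ... | yes eq = H , subst (λ v → DP v F ⇝* H) (sym eq) steps , id , id
    ... | no x≢y =
      let satX  = DP-SaturatedMU satF mx
          satY  = DP-SaturatedMU satF my
          mainY = DP-Main satF mx x≢y my
          mainX = DP-Main satF my (x≢y ∘ sym) mx
          H₁ , steps₁ , H≋H₁  = step-first satY mainX steps ns
          H₂ , steps₂ , H₁≋H₂ = ⇝*-resp (≋ˢ-sym (DP-comm satF mx my x≢y))
            (DP-SaturatedMU satY mainX) (DP-SaturatedMU satX mainY) steps₁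
      in H₂ , sDP-step {v = var y} (proj₁ satX) (Main⇒Singular mainY) ◅ steps₂ , ≋ˢ-trans H≋H₁ H₁≋H₂

  -- By induction on the second reduction: `step-first` makes the first reduction begin with the
  -- same step, and the tails are then compared.
  nonsingular-unique : SaturatedMU F → F ⇝* G → Nonsingular G → F ⇝* H → Nonsingular H → G ≋ˢ H
  nonsingular-unique satF ε nsG ε nsH = id , id
  nonsingular-unique satF (sDP-step {v} _ s ◅ _) nsG ε nsH = ⊥-elim (nsH v s)
  nonsingular-unique {F} satF steps nsG (sDP-step {v} _ s ◅ steps′) nsH with Singular⇒Main F v s
  ... | x , refl , m with step-first satF m steps nsG
  ... | G′ , steps₁ , G≋G′ = ≋ˢ-trans G≋G′ (nonsingular-unique (DP-SaturatedMU satF m)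
    steps₁ (Nonsingular-resp G≋G′ nsG) steps′ nsH)

  -- Termination and uniqueness of the nonsingular result.

  singular? : ∀ F v → Dec (Singular F v)
  singular? F v = (ldeg F (pos v) ⊓ ldeg F (neg v)) ℕ.≟ 1

  Singular⇒∈-Vars : ∀ F v → Singular F v → v ∈ⱽ Vars F
  Singular⇒∈-Vars F v s with Singular⇒Main F v s
  ... | x , refl , _ , (C∈F , x∈C , _) , _ = ∈-Vars⁺ C∈F x∈C

  opaque

    -- Each step eliminates its variable and introduces none. The induction is on a bound `n` for
    -- the length of a list `vs` covering the variables.
    nonsingular-exists : ∀ n vs → length vs ≤ n → (∀ {v} → v ∈ⱽ Vars F → v ∈ⱽ vs) →
      SaturatedMU F → ∃[ G ] (F ⇝* G × MU G × Nonsingular G)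
    nonsingular-exists {F} n vs len F⊆vs satF with any? (singular? F) (Vars F)
    ... | no none = F , ε , proj₁ satF
      , λ v s → none (≡Membership.lose (Singular⇒∈-Vars F v s) s)
    ... | yes some with ≡Membership.find some
    ... | v , v∈F , s with Singular⇒Main F v s
    nonsingular-exists zero [] _ F⊆vs satF | yes _ | v , v∈F , s | x , refl , m with () ← F⊆vs v∈F
    nonsingular-exists {F} (suc n) vs len F⊆vs satF
      | yes _ | v , v∈F , s | x , refl , m@(_ , onlyC , _)
      with nonsingular-exists n (filter ≢x? vs)
        -- Filtering strictly shortens `vs`, because it contains the variable being eliminated.
        (ℕ.≤-pred (ℕ.≤-trans (filter-notAll ≢x? vs (Any.map (λ eq ≢x → ≢x (sym eq)) (F⊆vs v∈F))) len))
        (λ p → ∈-filter⁺ ≢x? (F⊆vs (Reduct-Vars⊆ satF onlyC (DP-Reduct satF m) p))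
          λ where refl → Reduct-var∉ satF onlyC (DP-Reduct satF m) p)
        (DP-SaturatedMU satF m)
      where
      ≢x? : ∀ u → Dec (u ≢ var x)
      ≢x? u = ¬? (u ≟ⱽ var x)
    ... | G , steps , rest = G , sDP-step {v = var x} (proj₁ satF) s ◅ steps , rest

  sDP-unique : (F : ClauseSet) → SaturatedMU F → ∃! _≋_ (sDP F)
  sDP-unique F satF with nonsingular-exists (length (Vars F)) (Vars F) ℕ.≤-refl id satF
  ... | G , steps , muG , nsG = G
    , (muG , nsG , G , steps , ≋ˢ⇒≋ (id , id))
    -- `G′` is only set-equal to the list `H` actually reached, so its nonsingularity is first
    -- carried over to `H`.
    , λ {G′} (_ , nsG′ , H , stepsH , H≋G′) → let H≋ˢG′ = ≋⇒≋ˢ {H} {G′} H≋G′ in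
        ≋ˢ⇒≋ (≋ˢ-trans (nonsingular-unique satF steps nsG stepsH
          (Nonsingular-resp (≋ˢ-sym H≋ˢG′) nsG′)) H≋ˢG′)

theorem23 : (V : Set) (_≟_ : DecidableEquality V) →
    let open ClauseSets V _≟_ in
    (F : ClauseSet) → SaturatedMU F → ∃! _≋_ (sDP F)
theorem23 = Confluence.sDP-unique
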